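{- For each $k\in\mathbb N$ there exist a bidirected graph $B$ and disjoint sets $\mathcal X$ and $\mathcal Y$ of signed vertices of $B$, each of size at least $k$, such that $B$ contains no two vertex-disjoint $\mathcal X$--$\mathcal Y$ paths, and for every set $S\subseteq V(B)$ of size $k$ there exists an $\mathcal X$--$\mathcal Y$ path in $B-S$.
   Context: A bidirected graph $B=(G,\sigma)$ consists of an undirected graph $G$ without loops (no two distinct edges have the same endvertices and the same signs at them) together with a signing $\sigma$ assigning to every pair $(u,e)$, $u$ an endvertex of edge $e$, a sign $\sigma(u,e)\in\{+,-\}$. A signed vertex is a pair $(v,\alpha)$, $v\in V(B)$, $\alpha\in\{+,-\}$; $V(\mathcal X)$ denotes the set of vertices appearing in a set $\mathcal X$ of signed vertices. A walk is a sequence $v_0\vec e_1v_1\dots\vec e_\ell v_\ell$ where $\vec e_j$ is the edge $e_j$ oriented from $v_{j-1}$ to $v_j$ and $\sigma(v_i,e_i)\neq\sigma(v_i,e_{i+1})$ for $1\le i\le\ell-1$; trivial if $\ell=0$. A nontrivial walk starts in the signed vertex $(v_0,\sigma(v_0,e_1))$ and ends in $(v_\ell,\sigma(v_\ell,e_\ell))$; $v_1,\dots,v_{\ell-1}$ are internal vertices. A path is a walk with all vertices distinct. A trivial walk $v$ is an $\mathcal X$--$\mathcal Y$ walk if there is $\alpha$ with $(v,\alpha)\in\mathcal X$, $(v,-\alpha)\in\mathcal Y$; a nontrivial walk is an $\mathcal X$--$\mathcal Y$ walk if it starts in a signed vertex of $\mathcal X$, ends in one of $\mathcal Y$, no internal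 vertex lies in $V(\mathcal X)\cup V(\mathcal Y)$, and neither its startvertex nor its endvertex forms a trivial $\mathcal X$--$\mathcal Y$ walk. An $\mathcal X$--$\mathcal Y$ path is an $\mathcal X$--$\mathcal Y$ walk that is a path. -}

module Defs where

open import Data.Nat using (ℕ; _≥_)
open import Data.Fin using (Fin)
open import Data.List using (List; []; _∷_; map; length)
open import Data.List.Membership.Propositional using (_∈_; _∉_)
open import Data.List.Relation.Unary.All using (All)
open import Data.List.Relation.Unary.Unique.Propositional using (Unique)
open import Data.List.Relation.Unary.AllPairs using (AllPairs)
open import Data.Product using (Σ; _×_; _,_; ∃; ∃-syntax)
open import Data.Sum using (_⊎_)
open import Data.Unit using (⊤)
open import Data.Empty using (⊥)
open import Relation.Nullary using (¬_)
open import Relation.Binary.PropositionalEquality using (_≡_; _≢_)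

data Sign : Set where
  plus minus : Sign

neg : Sign → Sign
neg plus  = minus
neg minus = plus

record Edge (n : ℕ) : Set where
  constructor edge
  field
    end₁  : Fin n
    sign₁ : Sign
    end₂  : Fin n
    sign₂ : Sign
    noLoop : end₁ ≢ end₂
open Edge public

-- Two edges have the same endvertices with the same signs at them
-- (edges are unordered, so both orientations are considered).
SameEdge : ∀ {n} → Edge n → Edge n → Set
SameEdge e f =
  (end₁ e ≡ end₁ f × sign₁ e ≡ sign₁ f × end₂ e ≡ end₂ f × sign₂ e ≡ sign₂ f)
  ⊎ (end₁ e ≡ end₂ f × sign₁ e ≡ sign₂ f × end₂ e ≡ end₁ f × sign₂ e ≡ sign₁ f)

record BiGraph : Set where
  field
    nV    : ℕ
    edges : List (Edge nV)
    noDup : AllPairs (λ e f → ¬ SameEdge e f) edges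
open BiGraph public

Vtx : BiGraph → Set
Vtx B = Fin (nV B)

EdgeIx : BiGraph → Set
EdgeIx B = Fin (length (edges B))

SignedVertex : BiGraph → Set
SignedVertex B = Vtx B × Sign

data Dir : Set where
  fwd bwd : Dir

module _ (B : BiGraph) where
  open import Data.List using (lookup)

  OEdge : Set
  OEdge = EdgeIx B × Dir

  edgeOf : OEdge → Edge (nV B)
  edgeOf (i , _) = lookup (edges B) i

  tailV : OEdge → Vtx B
  tailV (i , fwd) = end₁ (lookup (edges B) i)
  tailV (i , bwd) = end₂ (lookup (edges B) i)

  headV : OEdge → Vtx B
  headV (i , fwd) = end₂ (lookup (edges B) i)
  headV (i , bwd) = end₁ (lookup (edges B) i)

  tailS : OEdge → Sign
  tailS (i , fwd) = sign₁ (lookup (edges B) i)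
  tailS (i , bwd) = sign₂ (lookup (edges B) i)

  headS : OEdge → Sign
  headS (i , fwd) = sign₂ (lookup (edges B) i)
  headS (i , bwd) = sign₁ (lookup (edges B) i)

  record Walk : Set where
    constructor walk
    field
      start : Vtx B
      steps : List OEdge
  open Walk public

  vertices : Walk → List (Vtx B)
  vertices w = start w ∷ map headV (steps w)

  ChainFrom : OEdge → List OEdge → Set
  ChainFrom o [] = ⊤
  ChainFrom o (o' ∷ os) = tailV o' ≡ headV o × headS o ≢ tailS o' × ChainFrom o' os

  IsWalk : Walk → Set
  IsWalk (walk v []) = ⊤
  IsWalk (walk v (o ∷ os)) = tailV o ≡ v × ChainFrom o os

  IsPath : Walk → Set
  IsPath w = IsWalk w × Unique (vertices w)

  lastOE : OEdge → List OEdge → OEdge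
  lastOE o [] = o
  lastOE o (o' ∷ os) = lastOE o' os

  internals : OEdge → List OEdge → List (Vtx B)
  internals o [] = []
  internals o (o' ∷ os) = headV o ∷ internals o' os

  InV : List (SignedVertex B) → Vtx B → Set
  InV 𝒳 v = ∃[ α ] ((v , α) ∈ 𝒳)

  TrivialXY : List (SignedVertex B) → List (SignedVertex B) → Vtx B → Set
  TrivialXY 𝒳 𝒴 v = ∃[ α ] ((v , α) ∈ 𝒳 × (v , neg α) ∈ 𝒴)

  IsXYWalk : List (SignedVertex B) → List (SignedVertex B) → Walk → Set
  IsXYWalk 𝒳 𝒴 (walk v []) = TrivialXY 𝒳 𝒴 v
  IsXYWalk 𝒳 𝒴 (walk v (o ∷ os)) =
    IsWalk (walk v (o ∷ os))
    × (v , tailS o) ∈ 𝒳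
    × (headV (lastOE o os) , headS (lastOE o os)) ∈ 𝒴
    × All (λ u → ¬ (InV 𝒳 u ⊎ InV 𝒴 u)) (internals o os)
    × ¬ TrivialXY 𝒳 𝒴 v
    × ¬ TrivialXY 𝒳 𝒴 (headV (lastOE o os))

  IsXYPath : List (SignedVertex B) → List (SignedVertex B) → Walk → Set
  IsXYPath 𝒳 𝒴 w = IsXYWalk 𝒳 𝒴 w × IsPath w

  VertexDisjoint : Walk → Walk → Set
  VertexDisjoint P Q = All (λ u → u ∉ vertices Q) (vertices P)

  -- an 𝒳–𝒴 path in B − S: an 𝒳–𝒴 path of B none of whose vertices lies in S
  -- (the defining conditions only refer to vertices of the path itself)
  XYPathAvoiding : List (SignedVertex B) → List (SignedVertex B) → List (Vtx B) → Set
  XYPathAvoiding 𝒳 𝒴 S = ∃[ P ] (IsXYPath 𝒳 𝒴 P × All (λ u → u ∉ S) (vertices P))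

{-# OPTIONS --safe #-}
module Submission where

-- The graph is a grid whose edges descend from (h + 1 , c) to (h , c) and to
-- (h , c + 1), with sign plus at the upper and minus at the lower end, together
-- with the edges of the bottom row, which have sign plus at both ends.  𝒳 and 𝒴
-- are consecutive intervals of the top row, all signs being plus.  The signs
-- force an 𝒳–𝒴 walk to descend from some x to the bottom, to use exactly one
-- bottom edge, and to climb to some y.  Disjoint descents cannot exchange their
-- left-to-right order, so if two 𝒳–𝒴 paths were disjoint, their bottom edges
-- {p , p'} and {q , q'} would satisfy p < q' and q < p', impossible for disjoint
-- pairs of neighbours.  On the other hand, descending diagonally and then
-- vertically, one gets an 𝒳–𝒴 path from any choice of a diagonal from 𝒳, a
-- diagonal from 𝒴 and two neighbouring columns, and k vertices block at most k
-- of the k + 1 choices of each.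

open import Defs
open import Data.Nat using (ℕ; zero; suc; _+_; _*_; _≤_; _<_; _≥_; s≤s; z<s; s≤s⁻¹; ⌊_/2⌋)
open import Data.Nat.Properties
open import Data.Fin using (Fin; zero; suc; toℕ; fromℕ; fromℕ<; inject₁; combine; remQuot; _↑ˡ_; _↑ʳ_)
open import Data.Fin.Properties
  using (toℕ-injective; toℕ-inject₁; toℕ-fromℕ; toℕ-fromℕ<; toℕ<n; toℕ-↑ˡ; toℕ-↑ʳ;
         remQuot-combine; combine-remQuot; combine-injective; inject₁-injective; pigeonhole; ¬∀⟶∃¬)
open import Data.List using (List; []; _∷_; _++_; map; length; lookup; allFin; cartesianProduct)
open import Data.List.Properties using (length-map; length-tabulate)
open import Data.List.Membership.Propositional using (_∈_; _∉_)
open import Data.List.Membership.Propositional.Properties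
  using (∈-lookup; ∈-map⁺; ∈-map⁻; ∈-++⁺ˡ; ∈-++⁺ʳ; ∈-cartesianProduct⁺; ∈-allFin)
open import Data.List.Relation.Unary.All as All using (All; []; _∷_)
open import Data.List.Relation.Unary.All.Properties using (¬Any⇒All¬)
open import Data.List.Relation.Unary.AllPairs as AllPairs using (AllPairs; []; _∷_)
import Data.List.Relation.Unary.AllPairs.Properties as AllPairs
open import Data.List.Relation.Unary.Any using (Any; index; any?)
open import Data.List.Relation.Unary.Any.Properties using (lookup-index)
open import Data.List.Relation.Unary.Unique.Propositional using (Unique)
import Data.List.Relation.Unary.Unique.Propositional.Properties as Unique
open import Data.Product using (_×_; _,_; ∃; ∃-syntax; proj₁; proj₂; uncurry)
open import Data.Sum using (_⊎_; inj₁; inj₂; [_,_]′)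
open import Data.Sum.Properties using (inj₁-injective; inj₂-injective)
open import Data.Unit using (tt)
open import Function using (_∘_)
open import Relation.Nullary using (¬_; contradiction; yes; no)
open import Relation.Binary.PropositionalEquality

-- The bidirected grid.

module Grid (H W : ℕ) where

  V : Set
  V = Fin (suc H * suc W)

  -- `BiGraph` numbers its vertices by a single `Fin`, so grid points have to be encoded. Everything
  -- later relies only on the laws of `ht` and `col` given here, never on the encoding.
  abstract
    at : Fin (suc H) → Fin (suc W) → V
    at = combine

    at-injective : ∀ h c h' c' → at h c ≡ at h' c' → h ≡ h' × c ≡ c'
    at-injective = combine-injective

    ht col : V → ℕ
    ht v = toℕ (proj₁ (remQuot {suc H} (suc W) v))
    col v = toℕ (proj₂ (remQuot {suc H} (suc W) v))

    ht-at : ∀ h c → ht (at h c) ≡ toℕ h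
    ht-at h c = cong (toℕ ∘ proj₁) (remQuot-combine h c)

    col-at : ∀ h c → col (at h c) ≡ toℕ c
    col-at h c = cong (toℕ ∘ proj₂) (remQuot-combine h c)

    coordinates-injective : ∀ {v w} → ht v ≡ ht w → col v ≡ col w → v ≡ w
    coordinates-injective {v} {w} p q = begin
      v                                             ≡⟨ combine-remQuot {suc H} (suc W) v ⟨
      uncurry combine (remQuot {suc H} (suc W) v)   ≡⟨ cong₂ combine (toℕ-injective p) (toℕ-injective q) ⟩
      uncurry combine (remQuot {suc H} (suc W) w)   ≡⟨ combine-remQuot {suc H} (suc W) w ⟩
      w                                             ∎
      where open ≡-Reasoning

    ht≤H : ∀ v → ht v ≤ H
    ht≤H v = s≤s⁻¹ (toℕ<n (proj₁ (remQuot {suc H} (suc W) v)))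

    col≤W : ∀ v → col v ≤ W
    col≤W v = s≤s⁻¹ (toℕ<n (proj₂ (remQuot {suc H} (suc W) v)))

  -- `inj₁ (h , c , b)` stands for the edge from `(h + 1 , c)` down to `(h , c + b)`, and `inj₂ c`
  -- for the bottom edge between columns `c` and `c + 1`. No edge descends from column `W`, since
  -- its diagonal edge would leave the grid.
  Arc : Set
  Arc = (Fin H × Fin W × Fin 2) ⊎ Fin W

  shift : Fin 2 → Fin W → Fin (suc W)
  shift zero    c = inject₁ c
  shift (suc _) c = suc c

  toℕ-shift : ∀ b c → toℕ (shift b c) ≡ toℕ b + toℕ c
  toℕ-shift zero       c = toℕ-inject₁ c
  toℕ-shift (suc zero) c = refl

  suc≢inject₁ : ∀ {n} (i : Fin n) → suc i ≢ inject₁ i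
  suc≢inject₁ i eq = 1+n≢n (trans (cong toℕ eq) (toℕ-inject₁ i))

  arcEdge : Arc → Edge (suc H * suc W)
  arcEdge (inj₁ (h , c , b)) =
    edge (at (suc h) (inject₁ c)) plus (at (inject₁ h) (shift b c)) minus
         (suc≢inject₁ h ∘ proj₁ ∘ at-injective (suc h) (inject₁ c) (inject₁ h) (shift b c))
  arcEdge (inj₂ c) =
    edge (at zero (inject₁ c)) plus (at zero (suc c)) plus
         (suc≢inject₁ c ∘ sym ∘ proj₂ ∘ at-injective zero (inject₁ c) zero (suc c))

  arcs : List Arc
  arcs = map inj₁ (cartesianProduct (allFin H) (cartesianProduct (allFin W) (allFin 2)))
         ++ map inj₂ (allFin W)

  arcs-unique : Unique arcs
  arcs-unique = Unique.++⁺
    (Unique.map⁺ inj₁-injective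
      (Unique.cartesianProduct⁺ (Unique.allFin⁺ H)
        (Unique.cartesianProduct⁺ (Unique.allFin⁺ W) (Unique.allFin⁺ 2))))
    (Unique.map⁺ inj₂-injective (Unique.allFin⁺ W))
    λ (p , q) → case (∈-map⁻ inj₁ p) (∈-map⁻ inj₂ q)
    where
    case : ∀ {a : Arc} {A : Fin H × Fin W × Fin 2 → Set} {B : Fin W → Set} →
           (∃ λ x → A x × a ≡ inj₁ x) → ¬ (∃ λ y → B y × a ≡ inj₂ y)
    case (_ , _ , refl) (_ , _ , ())

  ∈-arcs : ∀ a → a ∈ arcs
  ∈-arcs (inj₁ (h , c , b)) =
    ∈-++⁺ˡ (∈-map⁺ inj₁ (∈-cartesianProduct⁺ (∈-allFin h) (∈-cartesianProduct⁺ (∈-allFin c) (∈-allFin b))))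
  ∈-arcs (inj₂ c) = ∈-++⁺ʳ (map inj₁ _) (∈-map⁺ inj₂ (∈-allFin c))

  shift-injective : ∀ b b' c → shift b c ≡ shift b' c → b ≡ b'
  shift-injective b b' c eq = toℕ-injective (+-cancelʳ-≡ (toℕ c) _ _
    (trans (sym (toℕ-shift b c)) (trans (cong toℕ eq) (toℕ-shift b' c))))

  -- In equal orientation the ends determine the arc. Opposite orientations are impossible: for
  -- descending edges the signs disagree, and for bottom edges each column would be the successor of
  -- the other. An arc of one kind never matches one of the other kind, because only bottom edges
  -- have two plus signs.
  arcEdge-injective : ∀ a a' → SameEdge (arcEdge a) (arcEdge a') → a ≡ a'
  arcEdge-injective (inj₁ (h , c , b)) (inj₁ (h' , c' , b')) (inj₁ (p , _ , q , _))
    with refl , p₂ ← at-injective (suc h) (inject₁ c) (suc h') (inject₁ c') p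
    with refl ← inject₁-injective p₂
    with refl ← shift-injective b b' c (proj₂ (at-injective (inject₁ h) (shift b c) (inject₁ h) (shift b' c) q)) = refl
  arcEdge-injective (inj₁ _) (inj₁ _) (inj₂ (_ , () , _))
  arcEdge-injective (inj₂ c) (inj₂ c') (inj₁ (p , _))
    with refl ← inject₁-injective (proj₂ (at-injective zero (inject₁ c) zero (inject₁ c') p)) = refl
  arcEdge-injective (inj₂ c) (inj₂ c') (inj₂ (p , _ , q , _)) =
    contradiction (trans (sym 1+c≡c') (cong suc c≡1+c')) (m≢1+n+m (toℕ c') {1})
    where
    c≡1+c' : toℕ c ≡ suc (toℕ c')
    c≡1+c' = trans (sym (toℕ-inject₁ c)) (cong toℕ (proj₂ (at-injective zero (inject₁ c) zero (suc c') p)))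
    1+c≡c' : suc (toℕ c) ≡ toℕ c'
    1+c≡c' = trans (cong toℕ (proj₂ (at-injective zero (suc c) zero (inject₁ c') q))) (toℕ-inject₁ c')

  G : BiGraph
  G = record
    { nV    = suc H * suc W
    ; edges = map arcEdge arcs
    ; noDup = AllPairs.map⁺ (AllPairs.map (λ a≢a' → a≢a' ∘ arcEdge-injective _ _) arcs-unique)
    }

  -- Edges as descents, climbs and bottom edges.

  Descending : V → Sign → V → Sign → Set
  Descending v s w t =
    s ≡ plus × t ≡ minus × ht v ≡ suc (ht w) × (col w ≡ col v ⊎ col w ≡ suc (col v))

  Level : V → Sign → V → Sign → Set
  Level v s w t =
    s ≡ plus × t ≡ plus × ht v ≡ 0 × ht w ≡ 0 × (col w ≡ suc (col v) ⊎ col v ≡ suc (col w))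

  data Kind (o : OEdge G) : Set where
    down  : Descending (tailV G o) (tailS G o) (headV G o) (headS G o) → Kind o
    up    : Descending (headV G o) (headS G o) (tailV G o) (tailS G o) → Kind o
    level : Level (tailV G o) (tailS G o) (headV G o) (headS G o) → Kind o

  arcDescending : ∀ h c b → let e = arcEdge (inj₁ (h , c , b)) in
                  Descending (end₁ e) (sign₁ e) (end₂ e) (sign₂ e)
  arcDescending h c b = refl , refl , heights , columns b
    where
    heights = begin
      ht (at (suc h) (inject₁ c))              ≡⟨ ht-at (suc h) (inject₁ c) ⟩
      suc (toℕ h)                              ≡⟨ cong suc (toℕ-inject₁ h) ⟨
      suc (toℕ (inject₁ h))                    ≡⟨ cong suc (ht-at (inject₁ h) (shift b c)) ⟨
      suc (ht (at (inject₁ h) (shift b c)))    ∎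
      where open ≡-Reasoning
    start≡ : toℕ c ≡ col (at (suc h) (inject₁ c))
    start≡ = sym (trans (col-at (suc h) (inject₁ c)) (toℕ-inject₁ c))
    columns : ∀ b → col (at (inject₁ h) (shift b c)) ≡ col (at (suc h) (inject₁ c))
                  ⊎ col (at (inject₁ h) (shift b c)) ≡ suc (col (at (suc h) (inject₁ c)))
    columns zero       = inj₁ (trans (col-at (inject₁ h) (inject₁ c)) (trans (toℕ-inject₁ c) start≡))
    columns (suc zero) = inj₂ (trans (col-at (inject₁ h) (suc c)) (cong suc start≡))

  arcLevel : ∀ c → let e = arcEdge (inj₂ c) in Level (end₁ e) (sign₁ e) (end₂ e) (sign₂ e)
  arcLevel c = refl , refl , ht-at zero (inject₁ c) , ht-at zero (suc c) ,
    inj₁ (trans (col-at zero (suc c)) (cong suc (sym (trans (col-at zero (inject₁ c)) (toℕ-inject₁ c)))))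

  reverse : OEdge G → OEdge G
  reverse (i , fwd) = i , bwd
  reverse (i , bwd) = i , fwd

  tailV-reverse : ∀ o → tailV G (reverse o) ≡ headV G o
  tailV-reverse (i , fwd) = refl
  tailV-reverse (i , bwd) = refl

  headV-reverse : ∀ o → headV G (reverse o) ≡ tailV G o
  headV-reverse (i , fwd) = refl
  headV-reverse (i , bwd) = refl

  tailS-reverse : ∀ o → tailS G (reverse o) ≡ headS G o
  tailS-reverse (i , fwd) = refl
  tailS-reverse (i , bwd) = refl

  headS-reverse : ∀ o → headS G (reverse o) ≡ tailS G o
  headS-reverse (i , fwd) = refl
  headS-reverse (i , bwd) = refl

  -- Recovers the arc behind an oriented edge, so that walks can be analysed by heights, columns and
  -- signs alone.
  kind : ∀ o → Kind o
  kind (i , d) with ∈-map⁻ arcEdge (∈-lookup {xs = edges G} i)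
  kind (i , fwd) | inj₁ (h , c , b) , _ , eq = down
    (subst (λ e → Descending (end₁ e) (sign₁ e) (end₂ e) (sign₂ e)) (sym eq) (arcDescending h c b))
  kind (i , bwd) | inj₁ (h , c , b) , _ , eq = up
    (subst (λ e → Descending (end₁ e) (sign₁ e) (end₂ e) (sign₂ e)) (sym eq) (arcDescending h c b))
  kind (i , fwd) | inj₂ c , _ , eq = level
    (subst (λ e → Level (end₁ e) (sign₁ e) (end₂ e) (sign₂ e)) (sym eq) (arcLevel c))
  kind (i , bwd) | inj₂ c , _ , eq = level
    (flip-level (subst (λ e → Level (end₁ e) (sign₁ e) (end₂ e) (sign₂ e)) (sym eq) (arcLevel c)))
    where
    flip-level : ∀ {v s w t} → Level v s w t → Level w t v s
    flip-level (p , q , r , s , inj₁ x) = q , p , s , r , inj₂ x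
    flip-level (p , q , r , s , inj₂ x) = q , p , s , r , inj₁ x

  arcIx : Arc → EdgeIx G
  arcIx a = index (∈-map⁺ arcEdge (∈-arcs a))

  lookup-arcIx : ∀ a → arcEdge a ≡ lookup (edges G) (arcIx a)
  lookup-arcIx a = lookup-index (∈-map⁺ arcEdge (∈-arcs a))

  -- `b` selects the vertical edge (0) or the diagonal one (1).
  descent : ∀ v {h} → ht v ≡ suc h → col v < W → (b : Fin 2) →
            ∃ λ o → tailV G o ≡ v × tailS G o ≡ plus × headS G o ≡ minus
                  × ht (headV G o) ≡ h × col (headV G o) ≡ toℕ b + col v
  descent v {h} hv cv b = (arcIx a , fwd) ,
    trans (cong end₁ (sym eq)) (coordinates-injective
      (trans (ht-at _ _) (trans (cong suc (toℕ-fromℕ< h<H)) (sym hv)))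
      (trans (col-at _ _) (trans (toℕ-inject₁ _) (toℕ-fromℕ< cv)))) ,
    cong sign₁ (sym eq) , cong sign₂ (sym eq) ,
    trans (cong (ht ∘ end₂) (sym eq)) (trans (ht-at _ _) (trans (toℕ-inject₁ _) (toℕ-fromℕ< h<H))) ,
    trans (cong (col ∘ end₂) (sym eq)) (trans (col-at _ _)
      (trans (toℕ-shift b _) (cong (toℕ b +_) (toℕ-fromℕ< cv))))
    where
    h<H : h < H
    h<H = subst (_≤ H) hv (ht≤H v)
    a : Arc
    a = inj₁ (fromℕ< h<H , fromℕ< cv , b)
    eq = lookup-arcIx a

  bottom : ∀ v w → ht v ≡ 0 → ht w ≡ 0 → col w ≡ suc (col v) →
           ∃ λ o → tailV G o ≡ v × headV G o ≡ w × tailS G o ≡ plus × headS G o ≡ plus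
  bottom v w hv hw cw = (arcIx a , fwd) ,
    trans (cong end₁ (sym eq)) (coordinates-injective
      (trans (ht-at _ _) (sym hv))
      (trans (col-at _ _) (trans (toℕ-inject₁ _) (toℕ-fromℕ< c<W)))) ,
    trans (cong end₂ (sym eq)) (coordinates-injective
      (trans (ht-at _ _) (sym hw))
      (trans (col-at _ _) (trans (cong suc (toℕ-fromℕ< c<W)) (sym cw)))) ,
    cong sign₁ (sym eq) , cong sign₂ (sym eq)
    where
    c<W : col v < W
    c<W = subst (_≤ W) cw (col≤W w)
    a : Arc
    a = inj₂ (fromℕ< c<W)
    eq = lookup-arcIx a

  -- Descents, valleys and why two of them meet.

  -- Only membership of the vertices in `L` is recorded, not the edges. Hence the climbing part of a
  -- walk, read backwards, is a descent too, and disjointness of walks becomes disjointness of two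
  -- predicates.
  data Descends (L : V → Set) : V → V → Set where
    stop : ∀ {v} → L v → ht v ≡ 0 → Descends L v v
    step : ∀ {v w p} → L v → ht v ≡ suc (ht w) → col w ≡ col v ⊎ col w ≡ suc (col v) →
           Descends L w p → Descends L v p

  Neighbours : V → V → Set
  Neighbours p q = col q ≡ suc (col p) ⊎ col p ≡ suc (col q)

  start∈ : ∀ {L v p} → Descends L v p → L v
  start∈ (stop l _)     = l
  start∈ (step l _ _ _) = l

  end∈ : ∀ {L v p} → Descends L v p → L p
  end∈ (stop l _)     = l
  end∈ (step _ _ _ d) = end∈ d

  end-ht : ∀ {L v p} → Descends L v p → ht p ≡ 0
  end-ht (stop _ h)     = h
  end-ht (step _ _ _ d) = end-ht d

  -- Both descents are followed in parallel, at equal heights. In one step a column stays or grows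
  -- by one, so the left descent can at most catch up with the right one; equal columns at equal
  -- height would be a common vertex.
  disjoint-descents-ordered : ∀ {L M v w p q} → (∀ {u} → L u → ¬ M u) →
    Descends L v p → Descends M w q → ht v ≡ ht w → col v < col w → col p < col q
  disjoint-descents-ordered L∩M (stop _ _) (stop _ _) _ v<w = v<w
  disjoint-descents-ordered L∩M (stop _ hv) (step _ hw _ _) h≡ _ =
    contradiction (trans (sym hv) (trans h≡ hw)) 0≢1+n
  disjoint-descents-ordered L∩M (step _ hv _ _) (stop _ hw) h≡ _ =
    contradiction (trans (sym hw) (trans (sym h≡) hv)) 0≢1+n
  disjoint-descents-ordered {M = M} L∩M (step {v} {v'} _ hv cv d) (step {w} {w'} _ hw cw e) h≡ v<w =
    disjoint-descents-ordered L∩M d e h≡' (≤∧≢⇒< v'≤w' v'≢w')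
    where
    h≡' : ht v' ≡ ht w'
    h≡' = suc-injective (trans (sym hv) (trans h≡ hw))
    v'≢w' : col v' ≢ col w'
    v'≢w' c≡ = L∩M (start∈ d) (subst M (sym (coordinates-injective h≡' c≡)) (start∈ e))
    v'≤w' : col v' ≤ col w'
    v'≤w' = begin
      col v'        ≤⟨ [ (λ c → ≤-trans (≤-reflexive c) (n≤1+n _)) , ≤-reflexive ]′ cv ⟩
      suc (col v)   ≤⟨ v<w ⟩
      col w         ≤⟨ [ (λ c → ≤-reflexive (sym c)) , (λ c → ≤-trans (n≤1+n _) (≤-reflexive (sym c))) ]′ cw ⟩
      col w'        ∎
      where open ≤-Reasoning

  -- The names `left` and `right` refer to the feet below `v` and `w`; the bottom edge between them
  -- may run in either direction.
  record Valley (L : V → Set) (v w : V) : Set where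
    field
      {left right} : V
      descent₁     : Descends L v left
      descent₂     : Descends L w right
      neighbours   : Neighbours left right

  plus≢minus : plus ≢ minus
  plus≢minus ()

  ≢plus⇒minus : ∀ {s t} → s ≡ plus → s ≢ t → t ≡ minus
  ≢plus⇒minus {t = plus}  refl s≢t = contradiction refl s≢t
  ≢plus⇒minus {t = minus} _    _   = refl

  ≢minus⇒plus : ∀ {s t} → s ≡ minus → s ≢ t → t ≡ plus
  ≢minus⇒plus {t = minus} refl s≢t = contradiction refl s≢t
  ≢minus⇒plus {t = plus}  _    _   = refl

  -- Only an upward traversal leaves its tail with sign minus. It arrives with sign plus, so the
  -- next edge must again leave with minus. The argument `d` accumulates the climb so far as a
  -- descent to `q`.
  climb : ∀ {L q} o os → tailS G o ≡ minus → ChainFrom G o os → Descends L (tailV G o) q →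
          All L (map (headV G) (o ∷ os)) → Descends L (headV G (lastOE G o os)) q
  climb o os s _ _ _ with kind o
  climb o os s _ _ _ | down (s' , _)  = contradiction (trans (sym s') s) plus≢minus
  climb o os s _ _ _ | level (s' , _) = contradiction (trans (sym s') s) plus≢minus
  climb o [] s _ d (l ∷ []) | up (_ , _ , h , c) = step l h c d
  climb {L} {q} o (o' ∷ os) s (t , s≢s' , ch) d (l ∷ ls) | up (s₁ , _ , h , c) =
    climb o' os (≢plus⇒minus s₁ s≢s') ch (subst (λ v → Descends L v q) (sym t) (step l h c d)) ls

  -- Leaving with sign plus means descending or taking a bottom edge. A descent arrives with minus,
  -- so the next edge leaves with plus and the same alternative recurs; a bottom edge arrives with
  -- plus and turns the rest into a climb. The final sign plus excludes stopping on a descent.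
  valley : ∀ {L} o os → tailS G o ≡ plus → ChainFrom G o os → headS G (lastOE G o os) ≡ plus →
           All L (tailV G o ∷ map (headV G) (o ∷ os)) → Valley L (tailV G o) (headV G (lastOE G o os))
  valley o os s _ _ _ with kind o
  valley o os s _ _ _ | up (_ , s' , _) = contradiction (trans (sym s) s') plus≢minus
  valley o [] s _ e _ | down (_ , s' , _) = contradiction (trans (sym e) s') plus≢minus
  valley {L} o (o' ∷ os) s (t , s≢s' , ch) e (l ∷ l' ∷ ls) | down (_ , s₁ , h , c) = record
    { descent₁   = step l (trans h (cong (suc ∘ ht) (sym t)))
                     (subst (λ v → col v ≡ col (tailV G o) ⊎ col v ≡ suc (col (tailV G o))) (sym t) c) descent₁
    ; descent₂   = descent₂
    ; neighbours = neighbours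
    }
    where open Valley (valley o' os (≢minus⇒plus s₁ s≢s') ch e (subst L (sym t) l' ∷ ls))
  valley o [] _ _ _ (l ∷ l' ∷ []) | level (_ , _ , h , h' , n) = record
    { descent₁ = stop l h ; descent₂ = stop l' h' ; neighbours = n }
  valley {L} o (o' ∷ os) _ (t , s≢s' , ch) _ (l ∷ l' ∷ ls) | level (_ , s₁ , h , h' , n) = record
    { descent₁   = stop l h
    ; descent₂   = climb o' os (≢plus⇒minus s₁ s≢s') ch
                     (subst (λ v → Descends L v (headV G o)) (sym t) (stop l' h')) ls
    ; neighbours = n
    }

  valleys-meet : ∀ {L M v v' w w'} → ht v ≡ ht w' → ht w ≡ ht v' → col v < col w' → col w < col v' →
                 Valley L v v' → Valley M w w' → ¬ (∀ {u} → L u → ¬ M u)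
  valleys-meet {L} {M} hv hw v<w' w<v' P Q L∩M = apart (P.neighbours) (Q.neighbours)
    where
    module P = Valley P
    module Q = Valley Q
    p<q' : col P.left < col Q.right
    p<q' = disjoint-descents-ordered L∩M P.descent₁ Q.descent₂ hv v<w'
    q<p' : col Q.left < col P.right
    q<p' = disjoint-descents-ordered (λ m l → L∩M l m) Q.descent₁ P.descent₂ hw w<v'
    p≢q : col P.left ≢ col Q.left
    p≢q c≡ = L∩M (end∈ P.descent₁) (subst M
      (sym (coordinates-injective (trans (end-ht P.descent₁) (sym (end-ht Q.descent₁))) c≡)) (end∈ Q.descent₁))
    apart : Neighbours P.left P.right → ¬ Neighbours Q.left Q.right
    -- With both bottom edges running rightwards, the two inequalities force the feet `P.left` and
    -- `Q.left` into one column. In the other cases the inequalities already contradict each other.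
    apart (inj₁ p') (inj₁ q') = p≢q (≤-antisym
      (s≤s⁻¹ (subst (col P.left <_) q' p<q')) (s≤s⁻¹ (subst (col Q.left <_) p' q<p')))
    apart (inj₁ p') (inj₂ q) = <-asym p<q' (≤-trans (≤-reflexive (sym q)) (s≤s⁻¹ (subst (col Q.left <_) p' q<p')))
    apart (inj₂ p) (inj₁ q') = <-asym q<p' (≤-trans (≤-reflexive (sym p)) (s≤s⁻¹ (subst (col P.left <_) q' p<q')))
    apart (inj₂ p) (inj₂ q) = <-asym
      (<-trans (n<1+n _) (subst (_< col Q.right) p p<q')) (<-trans (n<1+n _) (subst (_< col P.right) q q<p'))

  -- Walks between terminal sets in the top row.

  module Terminals
    (𝒳 𝒴 : List (SignedVertex G))
    (𝒳-top : ∀ {v s} → (v , s) ∈ 𝒳 → s ≡ plus × ht v ≡ H)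
    (𝒴-top : ∀ {v s} → (v , s) ∈ 𝒴 → s ≡ plus × ht v ≡ H)
    (𝒳<𝒴 : ∀ {v w s t} → (v , s) ∈ 𝒳 → (w , t) ∈ 𝒴 → col v < col w)
    where

    ¬trivial : ∀ v → ¬ TrivialXY G 𝒳 𝒴 v
    ¬trivial v (s , x , y) = <-irrefl refl (𝒳<𝒴 x y)

    record Crossing (L : V → Set) : Set where
      field
        {x y} : V
        {s t} : Sign
        x∈𝒳   : (x , s) ∈ 𝒳
        y∈𝒴   : (y , t) ∈ 𝒴
        route : Valley L x y

    crossing : ∀ P → IsXYWalk G 𝒳 𝒴 P → Crossing (_∈ vertices G P)
    crossing (walk v []) triv = contradiction triv (¬trivial v)
    crossing P@(walk v (o ∷ os)) ((refl , ch) , x , y , _) = record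
      { x∈𝒳   = x
      ; y∈𝒴   = y
      ; route = valley o os (proj₁ (𝒳-top x)) ch (proj₁ (𝒴-top y)) (All.tabulate (λ u∈ → u∈))
      }

    -- As all of 𝒳 lies to the left of all of 𝒴, each walk starts to the left of where the other one
    -- ends, which is the crossed order that `valleys-meet` asks for.
    ¬disjoint : ∀ P Q → IsXYWalk G 𝒳 𝒴 P → IsXYWalk G 𝒳 𝒴 Q → ¬ VertexDisjoint G P Q
    ¬disjoint P Q p q dis = valleys-meet
      (trans (proj₂ (𝒳-top P.x∈𝒳)) (sym (proj₂ (𝒴-top Q.y∈𝒴))))
      (trans (proj₂ (𝒳-top Q.x∈𝒳)) (sym (proj₂ (𝒴-top P.y∈𝒴))))
      (𝒳<𝒴 P.x∈𝒳 Q.y∈𝒴) (𝒳<𝒴 Q.x∈𝒳 P.y∈𝒴) P.route Q.route (All.lookup dis)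
      where
      module P = Crossing (crossing P p)
      module Q = Crossing (crossing Q q)

    -- Building paths along prescribed tracks.

    visited : OEdge G → List (OEdge G) → List V
    visited o os = tailV G o ∷ map (headV G) (o ∷ os)

    -- Paths are built backwards from their end in 𝒴. The field `low` keeps internal vertices off
    -- the top row, and thereby away from all terminals.
    record Suffix (o : OEdge G) (os : List (OEdge G)) : Set where
      field
        chain  : ChainFrom G o os
        end∈𝒴  : (headV G (lastOE G o os) , headS G (lastOE G o os)) ∈ 𝒴
        low    : All (λ u → ht u < H) (internals G o os)
        unique : Unique (visited o os)

    prepend : ∀ o {o' os} → headV G o ≡ tailV G o' → headS G o ≢ tailS G o' → ht (headV G o) < H →
              All (tailV G o ≢_) (visited o' os) → Suffix o' os → Suffix o (o' ∷ os)
    prepend o {o'} {os} h≡t s≢s' h<H fresh r = record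
      { chain  = sym h≡t , s≢s' , chain
      ; end∈𝒴  = end∈𝒴
      ; low    = h<H ∷ low
      ; unique = subst (λ v → Unique (tailV G o ∷ v ∷ map (headV G) (o' ∷ os))) (sym h≡t) (fresh ∷ unique)
      }
      where open Suffix r

    visited-prepend : ∀ {Q : V → Set} o o' {os} → headV G o ≡ tailV G o' → Q (tailV G o) →
                      All Q (visited o' os) → All Q (visited o (o' ∷ os))
    visited-prepend {Q} o o' h≡t q (q' ∷ qs) = q ∷ subst Q (sym h≡t) q' ∷ qs

    suffix-path : ∀ {o os} → (tailV G o , tailS G o) ∈ 𝒳 → Suffix o os →
                  IsXYPath G 𝒳 𝒴 (walk (tailV G o) (o ∷ os))
    suffix-path x∈𝒳 r =
      ( (refl , chain) , x∈𝒳 , end∈𝒴 , All.map internal low , ¬trivial _ , ¬trivial _) , (refl , chain) , unique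
      where
      open Suffix r
      internal : ∀ {u} → ht u < H → ¬ (InV G 𝒳 u ⊎ InV G 𝒴 u)
      internal h<H (inj₁ (_ , u∈)) = <-irrefl (proj₂ (𝒳-top u∈)) h<H
      internal h<H (inj₂ (_ , u∈)) = <-irrefl (proj₂ (𝒴-top u∈)) h<H

    -- The vertices on the diagonal col + ht ≡ a as long as col ≤ p, and from there on in column p.
    Track : ℕ → ℕ → V → Set
    Track a p v = col v ≤ p × col v + ht v ≤ a × (col v + ht v ≡ a ⊎ col v ≡ p)

    -- A common vertex has column at most `p`, so on the second track it lies on the diagonal `b`;
    -- but the first track stays on or below the diagonal `a`. This separates the descending part of
    -- a path from its climbing part.
    tracks-disjoint : ∀ {a b p v} → a < b → Track a p v → ¬ Track b (suc p) v
    tracks-disjoint a<b (_ , ≤a , _) (_ , _ , inj₁ ≡b) = <⇒≱ a<b (≤-trans (≤-reflexive (sym ≡b)) ≤a)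
    tracks-disjoint a<b (≤p , _) (_ , _ , inj₂ ≡1+p)   = <⇒≱ (n<1+n _) (≤-trans (≤-reflexive (sym ≡1+p)) ≤p)

    -- The bound `p ≤ a` says that the diagonal reaches column `p` no later than in the bottom row.
    track-end : ∀ {a p v} → p ≤ a → ht v ≡ 0 → Track a p v → col v ≡ p
    track-end p≤a h (_ , _ , inj₂ c)  = c
    track-end {v = v} p≤a h (≤p , _ , inj₁ s) = ≤-antisym ≤p (≤-trans p≤a
      (≤-reflexive (trans (sym s) (trans (cong (col v +_) h) (+-identityʳ _)))))

    track-step : ∀ {a p v h} → p < W → ht v ≡ suc h → Track a p v →
                 ∃ λ o → tailV G o ≡ v × tailS G o ≡ plus × headS G o ≡ minus
                       × ht (headV G o) ≡ h × Track a p (headV G o)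
    track-step {a} {p} {v} {h} p<W hv (≤p , ≤a , t) with col v ≟ p
    -- Once in column `p`, the track continues vertically, also from the corner where diagonal and
    -- column meet.
    ... | yes c≡p = let o , tv , ts , hs , hh , hc = descent v hv (≤-<-trans ≤p p<W) zero in
      o , tv , ts , hs , hh , ≤-trans (≤-reflexive hc) ≤p ,
      ≤-trans (+-mono-≤ (≤-reflexive hc) (≤-trans (≤-reflexive hh) (≤-trans (n≤1+n h) (≤-reflexive (sym hv))))) ≤a ,
      inj₂ (trans hc c≡p)
    ... | no c≢p with t
    ...   | inj₂ c≡p = contradiction c≡p c≢p
    -- The diagonal edge preserves `col + ht`, and `c≢p` leaves room for one more column.
    ...   | inj₁ s≡a = let o , tv , ts , hs , hh , hc = descent v hv (≤-<-trans ≤p p<W) (suc zero)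
                           same = begin
                             col (headV G o) + ht (headV G o)   ≡⟨ cong₂ _+_ hc hh ⟩
                             suc (col v) + h                    ≡⟨ +-suc (col v) h ⟨
                             col v + suc h                      ≡⟨ cong (col v +_) hv ⟨
                             col v + ht v                       ≡⟨ s≡a ⟩
                             a                                  ∎ in
      o , tv , ts , hs , hh , ≤-trans (≤-reflexive hc) (≤∧≢⇒< ≤p c≢p) , ≤-reflexive same , inj₁ same
      where open ≡-Reasoning

    -- Obtained by following the track down from a vertex of 𝒴 and prepending each edge reversed.
    -- The bound `h ≤ ht u` makes the next vertex, one row lower, new.
    record Ascent (b p : ℕ) (h : ℕ) : Set where
      field
        {first} : OEdge G
        {rest}  : List (OEdge G)
        height  : ht (tailV G first) ≡ h
        sign    : tailS G first ≡ minus
        suffix  : Suffix first rest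
        above   : All (λ u → h ≤ ht u × Track b p u) (visited first rest)

    ascent-last : ∀ {b p y h} → p < W → (y , plus) ∈ 𝒴 → ht y ≡ suc h → Track b p y → Ascent b p h
    ascent-last {b} {p} {y} {h} p<W y∈𝒴 hy ty with e , te , se , se' , he , tr ← track-step p<W hy ty = record
      { first  = reverse e
      ; rest   = []
      ; height = trans (cong ht (tailV-reverse e)) he
      ; sign   = trans (tailS-reverse e) se'
      ; suffix = record
        { chain  = tt
        ; end∈𝒴  = subst₂ (λ v s → (v , s) ∈ 𝒴) (sym head≡) (sym (trans (headS-reverse e) se)) y∈𝒴
        ; low    = []
        ; unique = ((λ t≡h → 1+n≢n (begin
            suc h                       ≡⟨ hy ⟨
            ht y                        ≡⟨ cong ht head≡ ⟨
            ht (headV G (reverse e))    ≡⟨ cong ht t≡h ⟨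
            ht (tailV G (reverse e))    ≡⟨ cong ht (tailV-reverse e) ⟩
            ht (headV G e)              ≡⟨ he ⟩
            h                           ∎)) ∷ []) ∷ [] ∷ []
        }
      ; above  = subst Q (sym (tailV-reverse e)) (≤-reflexive (sym he) , tr)
               ∷ subst Q (sym head≡) (≤-trans (n≤1+n h) (≤-reflexive (sym hy)) , ty) ∷ []
      }
      where
      open ≡-Reasoning
      Q : V → Set
      Q u = h ≤ ht u × Track b p u
      head≡ = trans (headV-reverse e) te

    ascent-extend : ∀ {b p h} → p < W → suc h < H → Ascent b p (suc h) → Ascent b p h
    ascent-extend {b} {p} {h} p<W h<H A
      with e , te , se , se' , he , tr ← track-step p<W (Ascent.height A) (proj₂ (All.head (Ascent.above A))) = record
      { first  = reverse e
      ; rest   = A.first ∷ A.rest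
      ; height = height
      ; sign   = trans (tailS-reverse e) se'
      ; suffix = prepend (reverse e) head≡
          (λ s≡ → plus≢minus (trans (sym se) (trans (sym (headS-reverse e)) (trans s≡ A.sign))))
          (subst (_< H) (sym (trans (cong ht head≡) A.height)) h<H)
          (All.map (λ (h< , _) v≡ → <⇒≱ h< (≤-reflexive (trans (cong ht (sym v≡)) height))) A.above)
          A.suffix
      ; above  = visited-prepend (reverse e) A.first head≡
          (≤-reflexive (sym height) , subst (Track b p) (sym (tailV-reverse e)) tr)
          (All.map (λ (h< , t) → <⇒≤ h< , t) A.above)
      }
      where
      module A = Ascent A
      height = trans (cong ht (tailV-reverse e)) he
      head≡ = trans (headV-reverse e) te

    ascent : ∀ {b p} h → p < W → h < H → Ascent b p h → Ascent b p 0
    ascent zero    p<W h<H A = A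
    ascent (suc h) p<W h<H A = ascent h p<W (<⇒≤ h<H) (ascent-extend p<W h<H A)

    -- Contains the rest of the descent, the bottom edge and the whole ascent. A vertex prepended
    -- one row higher is new: by height against the descending part, by `tracks-disjoint` against
    -- the ascent.
    record Descent (a b p : ℕ) (h : ℕ) (v : V) : Set where
      field
        {first} : OEdge G
        {rest}  : List (OEdge G)
        start≡  : tailV G first ≡ v
        sign    : tailS G first ≡ plus
        suffix  : Suffix first rest
        below   : All (λ u → (ht u ≤ h × Track a p u) ⊎ Track b (suc p) u) (visited first rest)

    descent-last : ∀ {a b p v} → 0 < H → a < b → p ≤ a → suc p ≤ b → ht v ≡ 0 → col v ≡ p →
                   Ascent b (suc p) 0 → Descent a b p 0 v
    descent-last {a} {b} {p} {v} 0<H a<b p≤a p<b hv cv A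
      with e , te , he , se , se' ← bottom v (tailV G (Ascent.first A)) hv (Ascent.height A)
             (trans (track-end p<b (Ascent.height A) (proj₂ (All.head (Ascent.above A)))) (cong suc (sym cv))) = record
      { first  = e
      ; start≡ = te
      ; sign   = se
      ; suffix = prepend e he (λ s≡ → plus≢minus (trans (sym se') (trans s≡ A.sign)))
          (subst (_< H) (sym (trans (cong ht he) A.height)) 0<H)
          (All.map (λ (_ , t) v≡ → tracks-disjoint a<b tv (subst (Track b (suc p)) (trans (sym v≡) te) t)) A.above)
          A.suffix
      ; below  = visited-prepend e A.first he
          (inj₁ (≤-reflexive (trans (cong ht te) hv) , subst (Track a p) (sym te) tv))
          (All.map (inj₂ ∘ proj₂) A.above)
      }
      where
      module A = Ascent A
      tv : Track a p v
      tv = ≤-reflexive cv , ≤-trans (≤-reflexive (trans (cong₂ _+_ cv hv) (+-identityʳ p))) p≤a , inj₂ cv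

    descent-extend : ∀ {a b p h v w} e → a < b → h < H → ht v ≡ suc h → Track a p v → tailV G e ≡ v →
                     tailS G e ≡ plus → headS G e ≡ minus → headV G e ≡ w → ht w ≡ h →
                     Descent a b p h w → Descent a b p (suc h) v
    descent-extend {a} {b} {p} {h} {v} e a<b h<H hv tv te se se' he hw D = record
      { first  = e
      ; start≡ = te
      ; sign   = se
      ; suffix = prepend e head≡ (λ s≡ → plus≢minus (trans (sym sign) (trans (sym s≡) se')))
          (subst (_< H) (sym (trans (cong ht he) hw)) h<H) (All.map fresh below) suffix
      ; below  = visited-prepend e first head≡ (inj₁ (≤-reflexive (trans (cong ht te) hv) , subst (Track a p) (sym te) tv))
          (All.map [ (λ (≤h , t) → inj₁ (≤-trans ≤h (n≤1+n h) , t)) , inj₂ ]′ below)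
      }
      where
      open Descent D
      head≡ = trans he (sym start≡)
      fresh : ∀ {u} → (ht u ≤ h × Track a p u) ⊎ Track b (suc p) u → tailV G e ≢ u
      fresh (inj₁ (≤h , _)) v≡ =
        <⇒≱ (n<1+n h) (≤-trans (≤-reflexive (trans (sym hv) (cong ht (trans (sym te) v≡)))) ≤h)
      fresh (inj₂ t) v≡ = tracks-disjoint a<b tv (subst (Track b (suc p)) (trans (sym v≡) te) t)

    descend : ∀ {a b p v} h → 0 < H → suc p < W → a < b → p ≤ a → suc p ≤ b → h ≤ H →
              ht v ≡ h → Track a p v → Ascent b (suc p) 0 → Descent a b p h v
    descend zero 0<H p<W a<b p≤a p<b h≤H hv tv A =
      descent-last 0<H a<b p≤a p<b hv (track-end p≤a hv tv) A
    descend (suc h) 0<H p<W a<b p≤a p<b h≤H hv tv A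
      with e , te , se , se' , he , tr ← track-step (<⇒≤ p<W) hv tv =
      descent-extend e a<b h≤H hv tv te se se' refl he
        (descend h 0<H p<W a<b p≤a p<b (<⇒≤ h≤H) he tr A)

    path-along : ∀ {x y p} → 0 < H → (x , plus) ∈ 𝒳 → (y , plus) ∈ 𝒴 → col y ≤ suc p → col x ≤ p →
                 p ≤ H → suc p < W →
                 ∃ λ P → IsXYPath G 𝒳 𝒴 P
                       × All (λ u → Track (col x + H) p u ⊎ Track (col y + H) (suc p) u) (vertices G P)
    path-along {x} {y} {p} 0<H x∈𝒳 y∈𝒴 y≤ x≤ p≤H p<W = _ , suffix-path start∈𝒳 suffix ,
        All.map [ inj₁ ∘ proj₂ , inj₂ ]′ below
      where
      -- The terminals have height `H`, so these sums are the diagonals through `x` and `y`.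
      a<b : col x + H < col y + H
      a<b = +-monoˡ-< H (𝒳<𝒴 x∈𝒳 y∈𝒴)
      top : ∀ {v q} → ht v ≡ H → col v ≤ q → Track (col v + H) q v
      top {v} h c = c , ≤-reflexive (cong (col v +_) h) , inj₁ (cong (col v +_) h)
      climbing : ∀ h → ht y ≡ suc h → Ascent (col y + H) (suc p) 0
      climbing h hy = ascent h p<W (≤-trans (≤-reflexive (sym hy)) (ht≤H y))
        (ascent-last p<W y∈𝒴 hy (top (proj₂ (𝒴-top y∈𝒴)) y≤))
      positive : ∀ {n} → 0 < n → ∃ λ h → n ≡ suc h
      positive z<s = _ , refl
      p≤a : p ≤ col x + H
      p≤a = ≤-trans p≤H (m≤n+m H (col x))
      open Descent (descend H 0<H p<W a<b p≤a (≤-<-trans p≤a a<b) ≤-refl (proj₂ (𝒳-top x∈𝒳)) (top (proj₂ (𝒳-top x∈𝒳)) x≤)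
        (climbing (proj₁ (positive 0<H)) (trans (proj₂ (𝒴-top y∈𝒴)) (proj₂ (positive 0<H)))))
      start∈𝒳 : (tailV G first , tailS G first) ∈ 𝒳
      start∈𝒳 = subst₂ (λ v s → (v , s) ∈ 𝒳) (sym start≡) (sym sign) x∈𝒳

-- Pigeonhole and the choice of parameters.

-- If every target were hit, two of them would be hit at the same position of `S`, and so be equal.
-- Each member of `S` blocks at most one target.
unhit-target : ∀ {A : Set} {m} (S : List A) (key : A → ℕ) (target : Fin m → ℕ) →
               (∀ {i j} → target i ≡ target j → i ≡ j) → length S < m →
               ∃ λ i → ∀ {u} → u ∈ S → key u ≢ target i
unhit-target {m = m} S key target target-injective |S|<m =
  let i , unhit = ¬∀⟶∃¬ m (λ i → Any (λ u → key u ≡ target i) S) (λ i → any? (λ u → key u ≟ target i) S) some-unhit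
  in  i , λ u∈S → All.lookup (¬Any⇒All¬ S unhit) u∈S
  where
  some-unhit : ¬ (∀ i → Any (λ u → key u ≡ target i) S)
  some-unhit hit with i , j , i<j , eq ← pigeonhole |S|<m (λ i → index (hit i)) =
    <-irrefl (cong toℕ (target-injective (begin
      target i                          ≡⟨ lookup-index (hit i) ⟨
      key (lookup S (index (hit i)))    ≡⟨ cong (key ∘ lookup S) eq ⟩
      key (lookup S (index (hit j)))    ≡⟨ lookup-index (hit j) ⟩
      target j                          ∎))) i<j
    where open ≡-Reasoning

-- 𝒳 occupies columns `0` to `m - 1` of the top row and 𝒴 columns `m` to `2m - 1`. The `m` column
-- pairs `2h , 2h + 1` with `m ≤ h < 2m` lie to the right of all terminals. Width `4m` leaves them
-- short of the last column, and height `4m` lets every diagonal from a terminal reach them.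
module Example (m : ℕ) (0<m : 0 < m) where

  n : ℕ
  n = m + m

  open Grid (n + n) (n + n)

  top : Fin (n + n) → V
  top c = at (fromℕ (n + n)) (inject₁ c)

  ht-top : ∀ c → ht (top c) ≡ n + n
  ht-top c = trans (ht-at _ _) (toℕ-fromℕ (n + n))

  col-top : ∀ c → col (top c) ≡ toℕ c
  col-top c = trans (col-at (fromℕ (n + n)) (inject₁ c)) (toℕ-inject₁ c)

  x y : Fin m → V
  x i = top ((i ↑ˡ m) ↑ˡ n)
  y j = top ((m ↑ʳ j) ↑ˡ n)

  col-x : ∀ i → col (x i) ≡ toℕ i
  col-x i = trans (col-top _) (trans (toℕ-↑ˡ (i ↑ˡ m) n) (toℕ-↑ˡ i m))

  col-y : ∀ j → col (y j) ≡ m + toℕ j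
  col-y j = trans (col-top _) (trans (toℕ-↑ˡ (m ↑ʳ j) n) (toℕ-↑ʳ m j))

  positives : (Fin m → V) → List (SignedVertex G)
  positives f = map (λ i → f i , plus) (allFin m)

  ∈-positives : ∀ {f v s} → (v , s) ∈ positives f → ∃ λ i → v ≡ f i × s ≡ plus
  ∈-positives {f} v∈ with i , _ , refl ← ∈-map⁻ (λ i → f i , plus) v∈ = i , refl , refl

  length-positives : ∀ f → length (positives f) ≡ m
  length-positives f = trans (length-map _ (allFin m)) (length-tabulate {n = m} _)

  positives-unique : ∀ {f} → (∀ {i j} → f i ≡ f j → i ≡ j) → Unique (positives f)
  positives-unique f-injective = Unique.map⁺ (f-injective ∘ cong proj₁) (Unique.allFin⁺ m)

  x-injective : ∀ {i j} → x i ≡ x j → i ≡ j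
  x-injective {i} {j} eq = toℕ-injective (trans (sym (col-x i)) (trans (cong col eq) (col-x j)))

  y-injective : ∀ {i j} → y i ≡ y j → i ≡ j
  y-injective {i} {j} eq =
    toℕ-injective (+-cancelˡ-≡ m _ _ (trans (sym (col-y i)) (trans (cong col eq) (col-y j))))

  𝒳 𝒴 : List (SignedVertex G)
  𝒳 = positives x
  𝒴 = positives y

  𝒳-top : ∀ {v s} → (v , s) ∈ 𝒳 → s ≡ plus × ht v ≡ n + n
  𝒳-top v∈ with _ , refl , refl ← ∈-positives {x} v∈ = refl , ht-top _

  𝒴-top : ∀ {v s} → (v , s) ∈ 𝒴 → s ≡ plus × ht v ≡ n + n
  𝒴-top v∈ with _ , refl , refl ← ∈-positives {y} v∈ = refl , ht-top _

  𝒳<𝒴 : ∀ {v w s t} → (v , s) ∈ 𝒳 → (w , t) ∈ 𝒴 → col v < col w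
  𝒳<𝒴 v∈ w∈ with i , refl , refl ← ∈-positives {x} v∈ | j , refl , refl ← ∈-positives {y} w∈ = begin-strict
    col (x i)     ≡⟨ col-x i ⟩
    toℕ i         <⟨ toℕ<n i ⟩
    m             ≤⟨ m≤m+n m (toℕ j) ⟩
    m + toℕ j     ≡⟨ col-y j ⟨
    col (y j)     ∎
    where open ≤-Reasoning

  open Terminals 𝒳 𝒴 𝒳-top 𝒴-top 𝒳<𝒴

  path-avoiding : ∀ S → length S < m → XYPathAvoiding G 𝒳 𝒴 S
  path-avoiding S |S|<m
    -- Free diagonals are chosen first, one from 𝒳 and one from 𝒴; `col + ht` tells which diagonal a
    -- vertex of `S` blocks.
    with i , x-free ← unhit-target S (λ u → col u + ht u) (λ i → toℕ i + (n + n))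
           (toℕ-injective ∘ +-cancelʳ-≡ (n + n) _ _) |S|<m
    with j , y-free ← unhit-target S (λ u → col u + ht u) (λ j → (m + toℕ j) + (n + n))
           (toℕ-injective ∘ +-cancelˡ-≡ m _ _ ∘ +-cancelʳ-≡ (n + n) _ _) |S|<m
    -- Halving the column identifies the pair `2h , 2h + 1`, so a vertex of `S` blocks at most one
    -- pair.
    with l , l-free ← unhit-target S (λ u → ⌊ col u /2⌋) (λ l → m + toℕ l)
           (toℕ-injective ∘ +-cancelˡ-≡ m _ _) |S|<m
    = let P , path , tracks = path-along {p = h + h} (≤-trans 0<m (≤-trans (m≤m+n m m) (m≤m+n n n)))
                                (∈-map⁺ _ (∈-allFin i)) (∈-map⁺ _ (∈-allFin j)) y≤ x≤ p≤H p<W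
      in  P , path , All.map avoids tracks
    where
    h = m + toℕ l
    h<n : h < n
    h<n = +-monoʳ-< m (toℕ<n l)
    p<W : suc (h + h) < n + n
    p<W = subst (_< n + n) (+-suc h h) (+-mono-<-≤ h<n h<n)
    p≤H : h + h ≤ n + n
    p≤H = ≤-trans (n≤1+n _) (<⇒≤ p<W)
    m≤h = m≤m+n m (toℕ l)
    x≤ : col (x i) ≤ h + h
    x≤ = ≤-trans (≤-reflexive (col-x i)) (≤-trans (<⇒≤ (toℕ<n i)) (≤-trans m≤h (m≤m+n h h)))
    y≤ : col (y j) ≤ suc (h + h)
    y≤ = ≤-trans (≤-reflexive (col-y j)) (≤-trans (+-mono-≤ m≤h (≤-trans (<⇒≤ (toℕ<n j)) m≤h)) (n≤1+n _))
    avoids : ∀ {u} → Track (col (x i) + (n + n)) (h + h) u ⊎ Track (col (y j) + (n + n)) (suc (h + h)) u → u ∉ S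
    avoids (inj₁ (_ , _ , inj₁ diagonal)) u∈S = x-free u∈S (trans diagonal (cong (_+ (n + n)) (col-x i)))
    avoids (inj₁ (_ , _ , inj₂ column))   u∈S = l-free u∈S (trans (cong ⌊_/2⌋ column) (sym (n≡⌊n+n/2⌋ h)))
    avoids (inj₂ (_ , _ , inj₁ diagonal)) u∈S = y-free u∈S (trans diagonal (cong (_+ (n + n)) (col-y j)))
    -- Rounding up `(h + h) / 2` is rounding down half of `suc (h + h)`, so the odd column of the
    -- pair also has key `h`.
    avoids (inj₂ (_ , _ , inj₂ column))   u∈S = l-free u∈S (trans (cong ⌊_/2⌋ column) (sym (n≡⌈n+n/2⌉ h)))

theorem3p1 : (k : ℕ) → ∃[ B ] ∃[ 𝒳 ] ∃[ 𝒴 ]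
    (Unique {A = SignedVertex B} 𝒳 × Unique {A = SignedVertex B} 𝒴
    × All (λ x → x ∉ 𝒴) 𝒳
    × length 𝒳 ≥ k × length 𝒴 ≥ k
    × ¬ (∃[ P ] ∃[ Q ] (IsXYPath B 𝒳 𝒴 P × IsXYPath B 𝒳 𝒴 Q × VertexDisjoint B P Q))
    × ((S : List (Vtx B)) → Unique S → length S ≡ k → XYPathAvoiding B 𝒳 𝒴 S))
theorem3p1 k =
  G , 𝒳 , 𝒴 , positives-unique x-injective , positives-unique y-injective
  , All.tabulate (λ v∈𝒳 v∈𝒴 → <-irrefl refl (𝒳<𝒴 v∈𝒳 v∈𝒴))
  , large x , large y
  , (λ (P , Q , p , q , disjoint) → ¬disjoint P Q (proj₁ p) (proj₁ q) disjoint)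
  , λ S _ |S|≡k → path-avoiding S (s≤s (≤-reflexive |S|≡k))
  where
  -- With `k + 1` choices of each kind, a set of `k` vertices leaves one of each free.
  open Example (suc k) z<s
  open Grid (n + n) (n + n)
  open Terminals 𝒳 𝒴 𝒳-top 𝒴-top 𝒳<𝒴
  large : ∀ f → length (positives f) ≥ k
  large f = ≤-trans (n≤1+n k) (≤-reflexive (sym (length-positives f)))
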